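{- Let $W=(P,T,F)$ be a safe and sound Workflow net, with $T$ non-empty, initial place $i$ and output place $o$. Let $\mathcal{D}_W$ be the Declare specification over the alphabet $\Sigma=T$ whose constraint set consists of: the constraint $\textsc{AtMostOne}(i^{\rightarrow})$; the constraint $\textsc{End}({}^{\rightarrow}o)$; and, for every place $p\in P$ with ${}^{\rightarrow}p\neq\emptyset$ and $p^{\rightarrow}\neq\emptyset$, the constraint $\textsc{AlternatePrecedence}({}^{\rightarrow}p,\,p^{\rightarrow})$. Then $\mathcal{D}_W$ is bisimilar to $W$; that is, the reachability FSA of $W$ is bisimilar to the (trimmed) specification FSA of $\mathcal{D}_W$.
   Context: **Nets.** A Petri net is a bipartite graph $(P,T,F)$ with finite disjoint sets $P$ (places) and $T$ (transitions) and flow relation $F\subseteq (P\times T)\cup(T\times P)$. For a place $p$, its preset is ${}^{\rightarrow}p=\{t\in T: (t,p)\in F\}$ and its postset is $p^{\rightarrow}=\{t\in T:(p,t)\in F\}$. A Workflow net is a Petri net in which (1) there is a unique place $i$ (the initial place) with empty preset; (2) there is a unique place $o$ (the output place) with empty postset; (3) every place and every transition lies on a directed path of the graph from $i$ to $o$. **Behavior.** A marking is a function $M:P\to\mathbb{Z}_{\ge 0}$. The initial marking $M_0$ maps $i$ to $1$ and every other place to $0$. A marking $M$ enables $t\in T$ iff $M(p)>0$ for all places $p$ with $t\in p^{\rightarrow}$. If $t$ is enabled at $M$, it may fire, giving the marking $M'$ with $M'(p)=M(p)-[t\in p^{\rightarrow}]+[t\in{}^{\rightarrow}p]$ for every $p$,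 where $[\cdot]$ is $1$ if the condition holds and $0$ otherwise. A marking is reachable if it can be obtained from $M_0$ by a finite (possibly empty) sequence of firings. **Safe and sound.** $W$ is safe if $M(p)\le 1$ for every reachable marking $M$ and every place $p$. $W$ is sound if: (option to complete) from every reachable marking, the marking $M_f$ with $M_f(o)=1$ and $M_f(p)=0$ for $p\ne o$ can be reached by firing transitions; (proper completion) every reachable marking $M$ with $M(o)>0$ equals $M_f$; (no dead transitions) every $t\in T$ is enabled by some reachable marking. **$\mathrm{LTL}_f$ with past.** A trace over a finite alphabet $\Sigma$ is a finite sequence $\pi=\langle a_1,\dots,a_n\rangle$ of symbols of $\Sigma$ with $n\ge 1$; exactly one symbol occurs at each instant. Formulae are built from symbols $a\in\Sigma$, Boolean connectives, $\mathbf{X}$ (next), $\mathbf{U}$ (until), $\mathbf{Y}$ (yesterday), $\mathbf{S}$ (since). For $1\le k\le n$: $\pi,k\models a$ iff $a_k=a$; Boolean connectives as usual; $\pi,k\models\mathbf{X}\varphi$ iff $k<n$ and $\pi,k+1\models\varphi$; $\pi,k\models\mathbf{Y}\varphi$ iff $k>1$ and $\pi,k-1\models\varphi$; $\pi,k\models\varphi_1\mathbf{U}\varphi_2$ iff there is $j$ with $k\le j\le n$, $\pi,j\models\varphi_2$ and $\pi,l\models\varphi_1$ for all $k\le l<j$; $\pi,k\models\varphi_1\mathbf{S}\varphi_2$ iff there is $j$ with $1\le j\le k$, $\pi,j\models\varphi_2$ and $\pi,l\models\varphi_1$ for all $j<l\le k$. Abbreviations: $\mathbf{F}\varphi=\mathrm{true}\,\mathbf{U}\,\varphi$,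 $\mathbf{G}\varphi=\neg\mathbf{F}\neg\varphi$. A trace satisfies $\varphi$, written $\pi\models\varphi$, iff $\pi,1\models\varphi$. **Declare constraints.** For a non-empty set $A\subseteq\Sigma$, write $\bigvee A$ for the disjunction of its symbols. For non-empty $A,B\subseteq\Sigma$: - $\textsc{AtMostOne}(A)$ is the formula $\mathbf{G}(\bigvee A\to\neg\mathbf{X}\mathbf{F}\bigvee A)$; - $\textsc{End}(A)$ is the formula $\mathbf{G}\mathbf{F}\bigvee A$; - $\textsc{AlternatePrecedence}(B,A)$ is the formula $\mathbf{G}\big(\bigvee A\to\mathbf{Y}(\neg\bigvee A\;\mathbf{S}\;\bigvee B)\big)$. A Declare specification is given by a finite non-empty alphabet and a finite set of constraints; a trace satisfies the specification iff it satisfies the conjunction of all its constraint formulae. **Automata.** An FSA is a deterministic finite automaton $(S,s_0,S_F,\Sigma,\delta)$ with finite state set $S$, initial state $s_0$, accepting states $S_F\subseteq S$, and a (possibly partial) transition function $\delta:S\times\Sigma\rightharpoonup S$; a string is accepted if reading it from $s_0$ is defined throughout and ends in $S_F$. It is trimmed if every state is reachable from $s_0$ and from every state some accepting state is reachable; trimming removes all other states and preserves the language. The reachability FSA of a safe and sound Workflow net $W$ has as states the reachable markings, initial state $M_0$, set of accepting states $\{M_f\}$, alphabet $T$, and $\delta(M,t)=M'$ iff $t$ is enabled at $M$ and firing it gives $M'$ (undefined otherwise). A constraint automaton of a constraint formula $\varphi$ is an FSA over $\Sigma$ whose language is exactly the set of traces satisfying $\varphi$. The specification FSA of a Declare specification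 is the product (synchronous, recognizing the intersection of languages) of constraint automata of all its constraints, trimmed; its language is exactly the set of traces satisfying the specification. **Bisimilarity.** Two FSAs $(S,s_0,S_F,\Sigma,\delta)$ and $(S',s_0',S_F',\Sigma,\delta')$ are bisimilar iff there is a relation $\sim\,\subseteq S\times S'$ such that $s_0\sim s_0'$; whenever $s\sim s'$ and $a\in\Sigma$, $\delta(s,a)$ is defined iff $\delta'(s',a)$ is defined, and in that case $\delta(s,a)\sim\delta'(s',a)$; and whenever $s\sim s'$, $s\in S_F$ iff $s'\in S_F'$. -}

module Defs where

open import Data.Bool.Base using (Bool; T; if_then_else_)
import Data.Bool.Properties as Bool
open import Data.Empty using (⊥)
open import Data.Fin.Base as Fin using (Fin; zero; suc; toℕ; combine; funToFin)
open import Data.Fin.Properties using (combine-injective; finToFun-funToFin)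
open import Data.Fin.Subset using (Subset; Empty; _∈_)
open import Data.Fin.Subset.Properties using (_∈?_; nonempty?)
open import Data.List.Base as List using (List; []; _∷_; allFin; deduplicate; filter; foldr)
open import Data.List.NonEmpty.Base using (List⁺; toList)
open import Data.List.Relation.Unary.All as All using (All)
open import Data.Nat.Base using (ℕ; zero; suc; _+_; _∸_; _^_; _*_; _≤_; _<_; z≤n; s≤s)
open import Data.Nat.Properties using (_≤?_)
open import Data.Product.Base using (∃; ∃-syntax; _×_; _,_; proj₁)
open import Data.Refinement using (Refinement; value; proof; value-injective)
open import Data.Irrelevant using ([_])
open import Data.Sum.Base using (_⊎_; inj₁; inj₂)
open import Data.Unit.Base using (⊤; tt)
open import Data.Vec.Base using (Vec; lookup; tabulate; replicate; _[_]≔_)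
open import Data.Vec.Properties using (≡-dec; tabulate∘lookup; tabulate-cong)
open import Function.Bundles using (_⇔_; _↣_; mk↣; Injection)
open import Relation.Binary.Construct.Closure.ReflexiveTransitive using (Star; ε)
open import Relation.Binary.Definitions using (DecidableEquality)
open import Relation.Binary.PropositionalEquality using (_≡_; refl; sym; trans; cong; cong₂)
open import Relation.Nullary.Decidable using (does; no; map′; recompute; _×-dec_)
open import Relation.Nullary.Negation using (¬_)

record PetriNet : Set where
  field
    #P #T       : ℕ
    place⇒trans : Fin #P → Fin #T → Bool
    trans⇒place : Fin #T → Fin #P → Bool

  Place Transition : Set
  Place      = Fin #P
  Transition = Fin #T

  pre post : Place → Subset #T
  pre  p = tabulate λ t → trans⇒place t p
  post p = tabulate λ t → place⇒trans p t

  Node : Set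
  Node = Place ⊎ Transition

  _⟶_ : Node → Node → Set
  inj₁ p ⟶ inj₂ t = T (place⇒trans p t)
  inj₂ t ⟶ inj₁ p = T (trans⇒place t p)
  inj₁ _ ⟶ inj₁ _ = ⊥
  inj₂ _ ⟶ inj₂ _ = ⊥

  Path : Node → Node → Set
  Path = Star _⟶_

  -- Vectors rather than functions, so that _≡_ on markings is pointwise
  -- equality.
  Marking : Set
  Marking = Vec ℕ #P

  Enabled : Marking → Transition → Set
  Enabled M t = ∀ p → t ∈ post p → 0 < lookup M p

  -- The truncated subtraction is exact whenever t is enabled at M.
  fire : Marking → Transition → Marking
  fire M t = tabulate λ p →
    (lookup M p ∸ (if does (t ∈? post p) then 1 else 0))
      + (if does (t ∈? pre p) then 1 else 0)

  Fires : Marking → Transition → Marking → Set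
  Fires M t M′ = Enabled M t × M′ ≡ fire M t

  _↠_ : Marking → Marking → Set
  _↠_ = Star λ M M′ → ∃[ t ] Fires M t M′

record WorkflowNet : Set where
  field
    net : PetriNet
  open PetriNet net public
  field
    i o      : Place
    i-source : Empty (pre i)
    i-unique : ∀ p → Empty (pre p) → p ≡ i
    o-sink   : Empty (post o)
    o-unique : ∀ p → Empty (post p) → p ≡ o
    on-path  : ∀ x → Path (inj₁ i) x × Path x (inj₁ o)

  M₀ M_f : Marking
  M₀  = replicate #P 0 [ i ]≔ 1
  M_f = replicate #P 0 [ o ]≔ 1

  Reachable : Marking → Set
  Reachable M = M₀ ↠ M

  Safe : Set
  Safe = ∀ M → Reachable M → ∀ p → lookup M p ≤ 1

  record Sound : Set where
    field
      optionToComplete  : ∀ M → Reachable M → M ↠ M_f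
      properCompletion  : ∀ M → Reachable M → 0 < lookup M o → M ≡ M_f
      noDeadTransitions : ∀ t → ∃[ M ] (Reachable M × Enabled M t)

infix  8 ¬ᶠ_ 𝐗_ 𝐘_ 𝐅_ 𝐆_
infixr 7 _𝐔_ _𝐒_
infixr 6 _∧ᶠ_
infixr 5 _∨ᶠ_
infixr 4 _⇒ᶠ_

data Formula (Σ : Set) : Set where
  atom                   : Σ → Formula Σ
  true                   : Formula Σ
  ¬ᶠ_ 𝐗_ 𝐘_              : Formula Σ → Formula Σ
  _∧ᶠ_ _∨ᶠ_ _⇒ᶠ_ _𝐔_ _𝐒_ : Formula Σ → Formula Σ → Formula Σ

false : ∀ {Σ} → Formula Σ
false = ¬ᶠ true

𝐅_ 𝐆_ : ∀ {Σ} → Formula Σ → Formula Σ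
𝐅 φ = true 𝐔 φ
𝐆 φ = ¬ᶠ 𝐅 ¬ᶠ φ

Trace : Set → Set
Trace = List⁺

Instant : ∀ {Σ} → Trace Σ → Set
Instant π = Fin (List.length (toList π))

infix 3 _at_⊨_ _⊨_

-- Instants are numbered from 0, so instant k here is instant k + 1 of
-- the usual presentation.
_at_⊨_ : ∀ {Σ} (π : Trace Σ) → Instant π → Formula Σ → Set
π at k ⊨ atom a   = List.lookup (toList π) k ≡ a
π at k ⊨ true     = ⊤
π at k ⊨ ¬ᶠ φ     = ¬ (π at k ⊨ φ)
π at k ⊨ φ ∧ᶠ ψ   = π at k ⊨ φ × π at k ⊨ ψ
π at k ⊨ φ ∨ᶠ ψ   = π at k ⊨ φ ⊎ π at k ⊨ ψ
π at k ⊨ φ ⇒ᶠ ψ   = π at k ⊨ φ → π at k ⊨ ψ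
π at k ⊨ 𝐗 φ      = ∃[ j ] (toℕ j ≡ suc (toℕ k) × π at j ⊨ φ)
π at k ⊨ 𝐘 φ      = ∃[ j ] (toℕ k ≡ suc (toℕ j) × π at j ⊨ φ)
π at k ⊨ φ 𝐔 ψ    = ∃[ j ] (k Fin.≤ j × π at j ⊨ ψ ×
                      (∀ l → k Fin.≤ l → l Fin.< j → π at l ⊨ φ))
π at k ⊨ φ 𝐒 ψ    = ∃[ j ] (j Fin.≤ k × π at j ⊨ ψ ×
                      (∀ l → j Fin.< l → l Fin.≤ k → π at l ⊨ φ))

_⊨_ : ∀ {Σ} → Trace Σ → Formula Σ → Set
π ⊨ φ = π at zero ⊨ φ

-- The trailing false is neutral for the non-empty sets that constraints
-- are built from.
⋁ : ∀ {n} → Subset n → Formula (Fin n)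
⋁ {n} A = foldr (λ a φ → atom a ∨ᶠ φ) false (filter (_∈? A) (allFin n))

data Constraint (n : ℕ) : Set where
  AtMostOne End       : Subset n → Constraint n
  AlternatePrecedence : (B A : Subset n) → Constraint n

formula : ∀ {n} → Constraint n → Formula (Fin n)
formula (AtMostOne A)             = 𝐆 (⋁ A ⇒ᶠ ¬ᶠ 𝐗 𝐅 ⋁ A)
formula (End A)                   = 𝐆 𝐅 ⋁ A
formula (AlternatePrecedence B A) = 𝐆 (⋁ A ⇒ᶠ 𝐘 (¬ᶠ ⋁ A 𝐒 ⋁ B))

_≟ˢ_ : ∀ {n} → DecidableEquality (Subset n)
_≟ˢ_ = ≡-dec Bool._≟_

_≟ᶜ_ : ∀ {n} → DecidableEquality (Constraint n)
AtMostOne A ≟ᶜ AtMostOne A′ = map′ (cong AtMostOne) (λ { refl → refl }) (A ≟ˢ A′)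
AtMostOne _ ≟ᶜ End _ = no λ ()
AtMostOne _ ≟ᶜ AlternatePrecedence _ _ = no λ ()
End _ ≟ᶜ AtMostOne _ = no λ ()
End A ≟ᶜ End A′ = map′ (cong End) (λ { refl → refl }) (A ≟ˢ A′)
End _ ≟ᶜ AlternatePrecedence _ _ = no λ ()
AlternatePrecedence _ _ ≟ᶜ AtMostOne _ = no λ ()
AlternatePrecedence _ _ ≟ᶜ End _ = no λ ()
AlternatePrecedence B A ≟ᶜ AlternatePrecedence B′ A′ =
  map′ (λ { (refl , refl) → refl }) (λ { refl → refl , refl })
       (B ≟ˢ B′ ×-dec A ≟ˢ A′)

Specification : ℕ → Set
Specification n = List (Constraint n)

-- Distinct places may have equal presets and equal postsets;
-- deduplicating keeps one copy of each constraint, as in a set.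
𝒟 : (W : WorkflowNet) → Specification (WorkflowNet.#T W)
𝒟 W = deduplicate _≟ᶜ_
  (AtMostOne (post i) ∷ End (pre o) ∷
   List.map (λ p → AlternatePrecedence (pre p) (post p))
     (filter (λ p → nonempty? (pre p) ×-dec nonempty? (post p)) (allFin #P)))
  where open WorkflowNet W

-- The partial transition function is given by its graph.  Finiteness is
-- an injection into some Fin n, which for a subset of a finite set does
-- not depend on deciding membership.
record FSA (Σ : Set) : Set₁ where
  field
    State         : Set
    finite        : ∃[ n ] (State ↣ Fin n)
    initial       : State
    Accepting     : State → Set
    δ             : State → Σ → State → Set
    deterministic : ∀ {s a s′ s″} → δ s a s′ → δ s a s″ → s′ ≡ s″

  data Run : State → List Σ → State → Set where
    []  : ∀ {s} → Run s [] s
    _∷_ : ∀ {s a s′ w s″} → δ s a s′ → Run s′ w s″ → Run s (a ∷ w) s″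

  Accepts : List Σ → Set
  Accepts w = ∃[ s ] (Run initial w s × Accepting s)

  Useful : State → Set
  Useful s = (∃[ w ] Run initial w s) ×
             (∃[ w ] ∃[ s′ ] (Run s w s′ × Accepting s′))

open FSA using (State; initial; Accepting; δ; Accepts; Useful)

private
  restrict-finite : ∀ {S : Set} {P : S → Set} →
                    ∃[ n ] (S ↣ Fin n) → ∃[ n ] (Refinement S P ↣ Fin n)
  restrict-finite (n , f) =
    n , mk↣ {to = λ s → Injection.to f (value s)}
            (λ eq → value-injective (Injection.injective f eq))

-- Refinement makes membership proofs irrelevant, so that equality of
-- states is equality of the underlying values.
--
-- The language must be non-empty: otherwise trimming would remove the
-- initial state.
trim : ∀ {Σ} (A : FSA Σ) → ∃ (Accepts A) → FSA Σ
trim A (w , s , r , acc) = record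
  { State         = Refinement (State A) (Useful A)
  ; finite        = restrict-finite (FSA.finite A)
  ; initial       = record
      { value = initial A
      ; proof = [ ([] , FSA.[]) , (w , s , r , acc) ] }
  ; Accepting     = λ s → Accepting A (value s)
  ; δ             = λ s a s′ → δ A (value s) a (value s′)
  ; deterministic = λ d d′ → value-injective (FSA.deterministic A d d′)
  }

universal : ∀ {Σ} → FSA Σ
universal = record
  { State         = ⊤
  ; finite        = 1 , mk↣ {to = λ _ → zero} (λ _ → refl)
  ; initial       = tt
  ; Accepting     = λ _ → ⊤
  ; δ             = λ _ _ _ → ⊤
  ; deterministic = λ _ _ → refl
  }

_⊗_ : ∀ {Σ} → FSA Σ → FSA Σ → FSA Σ
A ⊗ B = record
  { State         = State A × State B
  ; finite        = ×-finite (FSA.finite A) (FSA.finite B)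
  ; initial       = initial A , initial B
  ; Accepting     = λ (s , t) → Accepting A s × Accepting B t
  ; δ             = λ (s , t) a (s′ , t′) → δ A s a s′ × δ B t a t′
  ; deterministic = λ (d , e) (d′ , e′) →
      cong₂ _,_ (FSA.deterministic A d d′) (FSA.deterministic B e e′)
  }
  where
  ×-finite : ∀ {S S′ : Set} → ∃[ m ] (S ↣ Fin m) → ∃[ n ] (S′ ↣ Fin n) →
             ∃[ k ] ((S × S′) ↣ Fin k)
  ×-finite (m , f) (n , g) =
    m * n ,
    mk↣ {to = λ (s , t) → combine (Injection.to f s) (Injection.to g t)}
        (λ eq → let (eq₁ , eq₂) = combine-injective _ _ _ _ eq in
                cong₂ _,_ (Injection.injective f eq₁) (Injection.injective g eq₂))

∏ : ∀ {Σ} → List (FSA Σ) → FSA Σ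
∏ = foldr _⊗_ universal

ConstraintAutomaton : ∀ {n} → Constraint n → Set₁
ConstraintAutomaton {n} c =
  ∃[ A ] ∀ (w : List (Fin n)) →
    Accepts A w ⇔ (∃[ π ] (toList π ≡ w × π ⊨ formula c))

specificationProduct : ∀ {n} {D : Specification n} →
                       All ConstraintAutomaton D → FSA (Fin n)
specificationProduct 𝒜 = ∏ (All.reduce proj₁ 𝒜)

specificationFSA : ∀ {n} {D : Specification n} (𝒜 : All ConstraintAutomaton D) →
                   ∃ (Accepts (specificationProduct 𝒜)) → FSA (Fin n)
specificationFSA 𝒜 = trim (specificationProduct 𝒜)

module _ (W : WorkflowNet) (safe : WorkflowNet.Safe W) where

  open WorkflowNet W

  private
    bit : ℕ → Fin 2
    bit zero    = zero
    bit (suc _) = suc zero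

    bit-injective : ∀ {m n} → m ≤ 1 → n ≤ 1 → bit m ≡ bit n → m ≡ n
    bit-injective z≤n       z≤n       _  = refl
    bit-injective (s≤s z≤n) (s≤s z≤n) _  = refl

    bounded : (s : Refinement Marking Reachable) → ∀ p → lookup (value s) p ≤ 1
    bounded record { value = M ; proof = [ r ] } p =
      recompute (lookup M p ≤? 1) (safe M r p)

    encode : Refinement Marking Reachable → Fin (2 ^ #P)
    encode s = funToFin λ p → bit (lookup (value s) p)

    encode-injective : ∀ {s s′} → encode s ≡ encode s′ → s ≡ s′
    encode-injective {s} {s′} eq = value-injective
      (trans (sym (tabulate∘lookup _))
        (trans (tabulate-cong pointwise) (tabulate∘lookup _)))
      where
      bits : Refinement Marking Reachable → Fin #P → Fin 2
      bits s p = bit (lookup (value s) p)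

      pointwise : ∀ p → lookup (value s) p ≡ lookup (value s′) p
      pointwise p = bit-injective (bounded s p) (bounded s′ p)
        (trans (sym (finToFun-funToFin (bits s) p))
          (trans (cong (λ k → Fin.finToFun k p) eq)
            (finToFun-funToFin (bits s′) p)))

  reachabilityFSA : FSA Transition
  reachabilityFSA = record
    { State         = Refinement Marking Reachable
    ; finite        = 2 ^ #P , mk↣ (λ {s} {s′} → encode-injective {s} {s′})
    ; initial       = record { value = M₀ ; proof = [ ε ] }
    ; Accepting     = λ s → value s ≡ M_f
    ; δ             = λ s t s′ → Fires (value s) t (value s′)
    ; deterministic = λ { (_ , eq) (_ , eq′) → value-injective (trans eq (sym eq′)) }
    }

record Bisimilar {Σ : Set} (A B : FSA Σ) : Set₁ where
  field
    _∼_       : State A → State B → Set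
    initial-∼ : initial A ∼ initial B
    defined-∼ : ∀ {s s′} → s ∼ s′ → ∀ a →
                (∃[ t ] δ A s a t) ⇔ (∃[ t′ ] δ B s′ a t′)
    δ-∼       : ∀ {s s′} → s ∼ s′ → ∀ {a t t′} →
                δ A s a t → δ B s′ a t′ → t ∼ t′
    accept-∼  : ∀ {s s′} → s ∼ s′ → Accepting A s ⇔ Accepting B s′

{-# OPTIONS --safe #-}
module Submission where

-- Deterministic automata with the same language are bisimilar once every
-- reachable state can still accept, so it suffices to compare languages.  In a
-- safe net the marking after a firing sequence can be read off the sequence: p
-- is marked iff it was initially marked, or has been produced into, and has not
-- been consumed from since.  Enabledness of each fired transition at its input
-- places is therefore what AtMostOne(i→) says about i and AlternatePrecedence
-- about every other place, and End(→o) is reaching M_f, by proper completion.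

open import Defs
open import Data.Nat.Base using (_<_)
open import Data.Product.Base using (∃-syntax)
open import Data.List.Relation.Unary.All using (All)
open WorkflowNet using (#T; Safe; Sound)

open import Data.Bool.Base using (T; if_then_else_)
open import Data.Bool.Properties using (T-≡)
open import Data.Empty using (⊥-elim)
open import Data.Fin.Base as Fin using (Fin; zero; suc; toℕ; fromℕ<)
open import Data.Fin.Properties as Fin using (toℕ-injective; toℕ-fromℕ<; toℕ<n; any?; all?)
open import Data.Fin.Subset using (Nonempty; _∈_; _∉_)
open import Data.Fin.Subset.Properties using (_∈?_; nonempty?)
open import Data.Irrelevant using ([_])
open import Data.List.Base as List using (List; []; _∷_; _++_; allFin; drop; filter; foldr; length)
open import Data.List.Membership.Propositional using () renaming (_∈_ to _∈ˡ_)
open import Data.List.Membership.Propositional.Properties using (∈-filter⁺; ∈-filter⁻; ∈-allFin)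
open import Data.List.NonEmpty.Base using (toList; _∷_)
open import Data.List.Properties using (length-drop)
open import Data.List.Relation.Unary.All as All using ([]; _∷_)
open import Data.List.Relation.Unary.All.Properties as All
  using (all-filter; deduplicate⁺; deduplicate⁻)
open import Data.List.Relation.Unary.Any using (here; there)
open import Data.Nat.Base using (ℕ; zero; suc; _≤_; z≤n; s≤s; s≤s⁻¹; _∸_; _+_)
open import Data.Nat.Properties as ℕ
  using (≤-refl; ≤-trans; <-≤-trans; ≤-<-trans; ≤-reflexive; <-irrefl; m<n⇒m<1+n;
         m≤n⇒m<n∨m≡n; m≤n⇒m∸n≡0; m∸n≡0⇒m≤n; m≤n+m)
open import Data.Product.Base using (∃; _×_; _,_; proj₁; proj₂; map₂)
open import Data.Refinement using (value; _,_)
open import Data.Sum.Base as Sum using (_⊎_; inj₁; inj₂)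
open import Data.Unit.Base using (tt)
open import Data.Vec.Base using (lookup; replicate; _[_]≔_)
open import Data.Vec.Properties
  using (lookup∘tabulate; lookup∘updateAt; lookup∘updateAt′; lookup-replicate; lookup⇒[]=)
open import Function.Base using (_∘_; id)
open import Function.Bundles using (_⇔_; mk⇔; Equivalence)
open import Relation.Binary.Construct.Closure.ReflexiveTransitive using (ε; _◅_; _◅◅_)
open import Relation.Binary.PropositionalEquality
  using (_≡_; _≢_; refl; sym; trans; cong; subst)
open import Relation.Nullary.Decidable
  using (Dec; does; yes; no; _×-dec_; _⊎-dec_; _→-dec_; ¬?; map′; recompute; decidable-stable)
open import Relation.Nullary.Negation using (¬_; contradiction)

open Equivalence using (to; from)
open FSA using (State; initial; Accepting; δ; Accepts; Useful; Run; deterministic)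
  renaming ([] to []ʳ; _∷_ to infixr 5 _∷ʳ_)

-- Runs of deterministic automata, and bisimilarity from equality of languages.

module _ {Σ : Set} (A : FSA Σ) where

  run-++ : ∀ {s u s′ v s″} → Run A s u s′ → Run A s′ v s″ → Run A s (u ++ v) s″
  run-++ []ʳ      r′ = r′
  run-++ (d ∷ʳ r) r′ = d ∷ʳ run-++ r r′

  run-split : ∀ {s} u {v s″} → Run A s (u ++ v) s″ → ∃[ s′ ] (Run A s u s′ × Run A s′ v s″)
  run-split []      r        = _ , []ʳ , r
  run-split (_ ∷ u) (d ∷ʳ r) =
    let _ , r₁ , r₂ = run-split u r in _ , d ∷ʳ r₁ , r₂

  run-deterministic : ∀ {s w s₁ s₂} → Run A s w s₁ → Run A s w s₂ → s₁ ≡ s₂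
  run-deterministic []ʳ       []ʳ = refl
  run-deterministic (d ∷ʳ r) (d′ ∷ʳ r′) with deterministic A d d′
  ... | refl = run-deterministic r r′

  -- The continuation of an accepted word from the state reached by a prefix.
  run-continue : ∀ {s} u {v s′} → Run A (initial A) u s → Run A (initial A) (u ++ v) s′ → Run A s v s′
  run-continue u r r′ with run-split u r′
  ... | _ , r₁ , r₂ with run-deterministic r r₁
  ...   | refl = r₂

module _ {Σ : Set} (A B : FSA Σ)
  (coaccessible : ∀ {w s} → Run A (initial A) w s →
                  ∃[ v ] ∃[ s′ ] (Run A s v s′ × Accepting A s′))
  (δ? : ∀ s a → Dec (∃[ s′ ] δ A s a s′))
  (same-language : ∀ w → Accepts A w ⇔ Accepts B w)
  (nonempty : ∃ (Accepts B))
  where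

  -- States are related when a common word leads to both of them.
  language≡⇒bisimilar : Bisimilar A (trim B nonempty)
  language≡⇒bisimilar = record
    { _∼_       = _∼_
    ; initial-∼ = [] , []ʳ , []ʳ
    ; defined-∼ = λ {_} {s′} s∼s′ a → mk⇔ (defined⇒ {s′ = s′} s∼s′) (defined⇐ {s′ = s′} s∼s′ a)
    ; δ-∼       = λ { (w , r , r′) d d′ →
        w ++ _ ∷ [] , run-++ A r (d ∷ʳ []ʳ) , run-++ B r′ (d′ ∷ʳ []ʳ) }
    ; accept-∼  = λ (w , r , r′) → mk⇔
        (λ acc → let _ , r″ , acc′ = to (same-language w) (_ , r , acc) in
          subst (Accepting B) (run-deterministic B r″ r′) acc′)
        (λ acc → let _ , r″ , acc′ = from (same-language w) (_ , r′ , acc) in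
          subst (Accepting A) (run-deterministic A r″ r) acc′)
    }
    where
    _∼_ : State A → State (trim B nonempty) → Set
    s ∼ s′ = ∃[ w ] (Run A (initial A) w s × Run B (initial B) w (value s′))

    -- The step in `A` extends to an accepted word. Splitting the accepting run of `B` on that word
    -- just after `a` gives a state whose usefulness is witnessed by the two halves.
    defined⇒ : ∀ {s s′ a} → s ∼ s′ → ∃[ t ] δ A s a t → ∃[ t′ ] δ (trim B nonempty) s′ a t′
    defined⇒ {a = a} (w , r , r′) (_ , d) =
      let r₁ = run-++ A r (d ∷ʳ []ʳ)
          v , _ , r₂ , acc = coaccessible r₁
          f , q , acc′ = to (same-language _) (_ , run-++ A r₁ r₂ , acc)
          m , q₁ , q₂ = run-split B (w ++ a ∷ []) q
      in (m , [ (_ , q₁) , (v , f , q₂ , acc′) ]) , step (run-continue B w r′ q₁)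
      where
      step : ∀ {s a s′} → Run B s (a ∷ []) s′ → δ B s a s′
      step (d ∷ʳ []ʳ) = d

    defined⇐ : ∀ {s s′} → s ∼ s′ → ∀ a → ∃[ t′ ] δ (trim B nonempty) s′ a t′ → ∃[ t ] δ A s a t
    -- The usefulness proof is irrelevant, so the transition derived from it can only be recovered
    -- by deciding that one exists.
    defined⇐ {s} (w , r , r′) a ((t′ , [ useful ]) , d) = recompute (δ? s a) (step useful)
      where
      first : ∀ {s a v} → ∃[ s″ ] Run A s (a ∷ v) s″ → ∃[ s′ ] δ A s a s′
      first (_ , d ∷ʳ _) = _ , d

      step : Useful B t′ → ∃[ t ] δ A s a t
      step (_ , (v , f , q , acc)) =
        let _ , r₁ , _ = from (same-language (w ++ a ∷ v)) (f , run-++ B r′ (d ∷ʳ q) , acc)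
        in first (_ , run-continue A w r r₁)

-- Languages of products of automata.

module _ {Σ : Set} (A B : FSA Σ) where

  ⊗-run : ∀ {s t w s′ t′} → Run (A ⊗ B) (s , t) w (s′ , t′) ⇔ (Run A s w s′ × Run B t w t′)
  ⊗-run = mk⇔ split merge
    where
    split : ∀ {s t w s′ t′} → Run (A ⊗ B) (s , t) w (s′ , t′) → Run A s w s′ × Run B t w t′
    split []ʳ = []ʳ , []ʳ
    split ((d , e) ∷ʳ r) = let q , q′ = split r in d ∷ʳ q , e ∷ʳ q′

    merge : ∀ {s t w s′ t′} → Run A s w s′ × Run B t w t′ → Run (A ⊗ B) (s , t) w (s′ , t′)
    merge ([]ʳ , []ʳ) = []ʳ
    merge (d ∷ʳ q , e ∷ʳ q′) = (d , e) ∷ʳ merge (q , q′)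

universal-run : ∀ {Σ : Set} (w : List Σ) → Run (universal {Σ}) tt w tt
universal-run []      = []ʳ
universal-run (_ ∷ w) = tt ∷ʳ universal-run w

∏-accepts : ∀ {Σ : Set} (As : List (FSA Σ)) w → Accepts (∏ As) w ⇔ All (λ A → Accepts A w) As
∏-accepts []       w = mk⇔ (λ _ → []) (λ _ → tt , universal-run w , tt)
∏-accepts (A ∷ As) w = mk⇔
  (λ (_ , r , acc , acc′) → let q , q′ = to (⊗-run A (∏ As)) r in
    (_ , q , acc) ∷ to (∏-accepts As w) (_ , q′ , acc′))
  (λ { ((_ , q , acc) ∷ accs) → let _ , q′ , acc′ = from (∏-accepts As w) accs in
    _ , from (⊗-run A (∏ As)) (q , q′) , acc , acc′ })

specificationProduct-accepts :
  ∀ {n} {D : Specification n} (𝒜 : All ConstraintAutomaton D) w →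
  Accepts (specificationProduct 𝒜) w ⇔ All (λ c → ∃[ π ] (toList π ≡ w × π ⊨ formula c)) D
specificationProduct-accepts 𝒜 w =
  mk⇔ (λ r → to (go 𝒜) (to (∏-accepts _ w) r)) (λ cs → from (∏-accepts _ w) (from (go 𝒜) cs))
  where
  go : ∀ {D} (𝒜 : All ConstraintAutomaton D) →
       All (λ A → Accepts A w) (All.reduce proj₁ 𝒜) ⇔ All (λ c → ∃[ π ] (toList π ≡ w × π ⊨ formula c)) D
  go []            = mk⇔ (λ _ → []) (λ _ → [])
  go ((_ , L) ∷ 𝒜) = mk⇔
    (λ { (a ∷ as) → to (L w) a ∷ to (go 𝒜) as })
    (λ { (c ∷ cs) → from (L w) c ∷ from (go 𝒜) cs })

-- Semantics of the three constraint templates.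

module _ {n} (π : Trace (Fin n)) where

  private
    a : Instant π → Fin n
    a = List.lookup (toList π)

  -- A trace has finitely many instants. Decidability is what removes the double negation that `𝐆`
  -- introduces.
  _⊨?_ : ∀ k φ → Dec (π at k ⊨ φ)
  k ⊨? atom b   = a k Fin.≟ b
  k ⊨? true     = yes tt
  k ⊨? (¬ᶠ φ)   = ¬? (k ⊨? φ)
  k ⊨? (φ ∧ᶠ ψ) = (k ⊨? φ) ×-dec (k ⊨? ψ)
  k ⊨? (φ ∨ᶠ ψ) = (k ⊨? φ) ⊎-dec (k ⊨? ψ)
  k ⊨? (φ ⇒ᶠ ψ) = (k ⊨? φ) →-dec (k ⊨? ψ)
  k ⊨? (𝐗 φ)    = any? λ j → (toℕ j ℕ.≟ suc (toℕ k)) ×-dec (j ⊨? φ)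
  k ⊨? (𝐘 φ)    = any? λ j → (toℕ k ℕ.≟ suc (toℕ j)) ×-dec (j ⊨? φ)
  k ⊨? (φ 𝐔 ψ)  = any? λ j → (k Fin.≤? j) ×-dec (j ⊨? ψ) ×-dec
                    all? λ l → (k Fin.≤? l) →-dec (l Fin.<? j) →-dec (l ⊨? φ)
  k ⊨? (φ 𝐒 ψ)  = any? λ j → (j Fin.≤? k) ×-dec (j ⊨? ψ) ×-dec
                    all? λ l → (j Fin.<? l) →-dec (l Fin.≤? k) →-dec (l ⊨? φ)

  ⊨𝐆 : ∀ φ → (π ⊨ 𝐆 φ) ⇔ (∀ k → π at k ⊨ φ)
  ⊨𝐆 φ = mk⇔
    (λ g k → decidable-stable (k ⊨? φ) λ ¬φ → g (k , z≤n , ¬φ , λ _ _ _ → tt))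
    (λ { g (k , _ , ¬φ , _) → ¬φ (g k) })

  ⊨⋁ : ∀ A k → (π at k ⊨ ⋁ A) ⇔ a k ∈ A
  ⊨⋁ A k = mk⇔
    (λ h → proj₂ (∈-filter⁻ (_∈? A) {xs = allFin n} (to (go _) h)))
    (λ h → from (go _) (∈-filter⁺ (_∈? A) (∈-allFin (a k)) h))
    where
    go : ∀ bs → (π at k ⊨ foldr (λ b φ → atom b ∨ᶠ φ) false bs) ⇔ a k ∈ˡ bs
    go []       = mk⇔ (λ ¬⊤ → ⊥-elim (¬⊤ tt)) (λ ())
    go (b ∷ bs) = mk⇔ Sum.[ here , there ∘ to (go bs) ]
      λ { (here eq) → inj₁ eq ; (there h) → inj₂ (from (go bs) h) }

  ⊨AtMostOne : ∀ A → (π ⊨ formula (AtMostOne A)) ⇔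
    (∀ k → a k ∈ A → ∀ l → l Fin.< k → a l ∉ A)
  ⊨AtMostOne A = mk⇔ sound complete
    where
    sound : π ⊨ formula (AtMostOne A) → ∀ k → a k ∈ A → ∀ l → l Fin.< k → a l ∉ A
    -- `𝐗` moves to instant `l + 1`, which exists because `l < k`, and `𝐅` then reaches `k`.
    sound g k k∈ l l<k l∈ = to (⊨𝐆 (⋁ A ⇒ᶠ ¬ᶠ 𝐗 𝐅 ⋁ A)) g l (from (⊨⋁ A l) l∈)
      (fromℕ< l+1<n , toℕ-fromℕ< l+1<n , k ,
       ≤-trans (≤-reflexive (toℕ-fromℕ< l+1<n)) l<k , from (⊨⋁ A k) k∈ , λ _ _ _ → tt)
      where
      l+1<n : suc (toℕ l) < length (toList π)
      l+1<n = ≤-<-trans l<k (toℕ<n k)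

    complete : (∀ k → a k ∈ A → ∀ l → l Fin.< k → a l ∉ A) → π ⊨ formula (AtMostOne A)
    complete h = from (⊨𝐆 (⋁ A ⇒ᶠ ¬ᶠ 𝐗 𝐅 ⋁ A)) λ { l l⊨ (j , j≡l+1 , k , j≤k , k⊨ , _) →
      h k (to (⊨⋁ A k) k⊨) l (≤-trans (≤-reflexive (sym j≡l+1)) j≤k) (to (⊨⋁ A l) l⊨) }

  ⊨End : ∀ A → (π ⊨ formula (End A)) ⇔ (∀ k → ∃[ j ] (k Fin.≤ j × a j ∈ A))
  ⊨End A = mk⇔
    (λ g k → let j , k≤j , j⊨ , _ = to (⊨𝐆 (𝐅 ⋁ A)) g k in j , k≤j , to (⊨⋁ A j) j⊨)
    (λ h → from (⊨𝐆 (𝐅 ⋁ A)) λ k → let j , k≤j , j∈ = h k in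
      j , k≤j , from (⊨⋁ A j) j∈ , λ _ _ _ → tt)

  -- `𝐘` evaluates `𝐒` at the instant before `k`, so the weak bounds of `𝐒` become strict bounds at
  -- `k`.
  ⊨AlternatePrecedence : ∀ B A → (π ⊨ formula (AlternatePrecedence B A)) ⇔
    (∀ k → a k ∈ A → ∃[ j ] (j Fin.< k × a j ∈ B × (∀ l → j Fin.< l → l Fin.< k → a l ∉ A)))
  ⊨AlternatePrecedence B A = mk⇔ sound complete
    where
    sound : π ⊨ formula (AlternatePrecedence B A) → _
    sound g k k∈ with to (⊨𝐆 (⋁ A ⇒ᶠ 𝐘 (¬ᶠ ⋁ A 𝐒 ⋁ B))) g k (from (⊨⋁ A k) k∈)
    ... | m , k≡m+1 , j , j≤m , j⊨ , avoid =
      j , ≤-trans (s≤s j≤m) (≤-reflexive (sym k≡m+1)) , to (⊨⋁ B j) j⊨ ,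
      λ l j<l l<k l∈ → avoid l j<l (s≤s⁻¹ (≤-trans l<k (≤-reflexive k≡m+1))) (from (⊨⋁ A l) l∈)

    complete : (∀ k → a k ∈ A →
      ∃[ j ] (j Fin.< k × a j ∈ B × (∀ l → j Fin.< l → l Fin.< k → a l ∉ A))) →
      π ⊨ formula (AlternatePrecedence B A)
    complete h = from (⊨𝐆 (⋁ A ⇒ᶠ 𝐘 (¬ᶠ ⋁ A 𝐒 ⋁ B))) λ k k⊨ → yesterday k (h k (to (⊨⋁ A k) k⊨))
      where
      yesterday : ∀ k → ∃[ j ] (j Fin.< k × a j ∈ B × (∀ l → j Fin.< l → l Fin.< k → a l ∉ A)) →
                  π at k ⊨ 𝐘 (¬ᶠ ⋁ A 𝐒 ⋁ B)
      -- Instant zero cannot occur, since `j` lies strictly before it; `inject₁ k` is the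
      -- predecessor as an instant of the same trace.
      yesterday (suc k) (j , j<k , j∈ , avoid) =
        Fin.inject₁ k , cong suc (sym (Fin.toℕ-inject₁ k)) , j ,
        ≤-trans (s≤s⁻¹ j<k) (≤-reflexive (sym (Fin.toℕ-inject₁ k))) , from (⊨⋁ B j) j∈ ,
        λ l j<l l≤k l⊨ →
          avoid l j<l (s≤s (≤-trans l≤k (≤-reflexive (Fin.toℕ-inject₁ k)))) (to (⊨⋁ A l) l⊨)

-- Suffixes of a word, and markings with a single token.

drop-[] : ∀ {X : Set} (w : List X) k → drop k w ≡ [] → length w ≤ k
drop-[] w k eq = m∸n≡0⇒m≤n (trans (sym (length-drop k w)) (cong length eq))

-- Lets an induction run along suffixes of a fixed word while the current letter keeps its instant
-- `c` in the whole word.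
drop-∷ : ∀ {X : Set} (w : List X) k {t v} → drop k w ≡ t ∷ v →
         ∃[ c ] (toℕ c ≡ k × List.lookup w c ≡ t × drop (suc k) w ≡ v)
drop-∷ (_ ∷ w) zero    refl = zero , refl , refl , refl
drop-∷ (_ ∷ w) (suc k) eq   =
  let c , c≡k , c↦t , eq′ = drop-∷ w k eq in suc c , cong suc c≡k , c↦t , eq′

unit-lookup : ∀ {n} (q p : Fin n) → 0 < lookup (replicate n 0 [ q ]≔ 1) p ⇔ p ≡ q
unit-lookup {n} q p = mk⇔ only (λ { refl → ≤-reflexive (sym (lookup∘updateAt q (replicate n 0))) })
  where
  only : 0 < lookup (replicate n 0 [ q ]≔ 1) p → p ≡ q
  only 0<p with p Fin.≟ q
  ... | yes p≡q = p≡q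
  ... | no  p≢q = contradiction
    (subst (0 <_) (trans (lookup∘updateAt′ p q p≢q (replicate n 0)) (lookup-replicate p 0)) 0<p) λ ()

-- Structure and firing rule of a Workflow net.

module _ (W : WorkflowNet) where

  open WorkflowNet W hiding (#T; Safe; Sound)

  ∈post : ∀ {p t} → T (place⇒trans p t) → t ∈ post p
  ∈post {p} {t} h = lookup⇒[]= t (post p) (trans (lookup∘tabulate _ t) (to T-≡ h))

  -- The net is bipartite, so the node just before `t` on the path is a place.
  input-place : ∀ {p t} → Path (inj₁ p) (inj₂ t) → ∃[ q ] t ∈ post q
  input-place {p} (_◅_ {j = inj₂ _} e ε) = p , ∈post {p} e
  input-place (_◅_ {j = inj₂ _} _ (_◅_ {j = inj₁ _} _ r)) = input-place r

  -- A path from `i` to any transition leaves `i` by an edge, while `o` has no outgoing edge. This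
  -- keeps `M₀` from being accepting, so that the empty word, which is no trace, is rejected.
  i≢o : 0 < #T W → i ≢ o
  i≢o 0<#T refl with proj₁ (on-path (inj₂ (fromℕ< 0<#T)))
  ... | _◅_ {j = inj₂ t} e _ = o-sink (t , ∈post {i} e)

  -- Every transition has an input place; under `M_f` it could only be `o`, from which nothing
  -- consumes.
  M_f-disabled : ∀ t → ¬ Enabled M_f t
  M_f-disabled t en with input-place (proj₁ (on-path (inj₂ t)))
  ... | q , t∈ with to (unit-lookup o q) (en q t∈)
  ...   | refl = o-sink (t , t∈)

  enabled? : ∀ M t → Dec (Enabled M t)
  enabled? M t = all? λ p → (t ∈? post p) →-dec (0 ℕ.<? lookup M p)

  -- Safety enters here: a place holding at most one token is emptied by a consumption, unless the
  -- same firing also produces into it.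
  fire-marks : ∀ M t p → lookup M p ≤ 1 →
               0 < lookup (fire M t) p ⇔ (t ∈ pre p ⊎ (t ∉ post p × 0 < lookup M p))
  fire-marks M t p M≤1 rewrite lookup∘tabulate
    (λ p → (lookup M p ∸ (if does (t ∈? post p) then 1 else 0)) + (if does (t ∈? pre p) then 1 else 0)) p
    with t ∈? pre p | t ∈? post p
  ... | yes t∈pre | _ = mk⇔ (λ _ → inj₁ t∈pre) (λ _ → m≤n+m 1 _)
  ... | no  t∉pre | yes t∈post rewrite m≤n⇒m∸n≡0 M≤1 =
    mk⇔ (λ ()) Sum.[ (λ t∈pre → contradiction t∈pre t∉pre) , (λ (t∉post , _) → contradiction t∈post t∉post) ]
  ... | no  t∉pre | no  t∉post rewrite ℕ.+-identityʳ (lookup M p) =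
    mk⇔ (λ 0<M → inj₂ (t∉post , 0<M)) Sum.[ (λ t∈pre → contradiction t∈pre t∉pre) , proj₂ ]

  reachable-fire : ∀ {M t M′} → Reachable M → Fires M t M′ → Reachable M′
  reachable-fire r f = r ◅◅ (_ , f) ◅ ε

  module _ (safe : Safe W) where

    -- The reachability proof inside a state is irrelevant, so a usable one is carried along the run
    -- separately.
    run-reachable : ∀ {s v f} → Run (reachabilityFSA W safe) s v f → Reachable (value s) → Reachable (value f)
    run-reachable []ʳ       r = r
    run-reachable (d ∷ʳ rs) r = run-reachable rs (reachable-fire r d)

    ↠⇒run : ∀ {M′} s → Reachable (value s) → value s ↠ M′ →
             ∃[ v ] ∃[ f ] (Run (reachabilityFSA W safe) s v f × value f ≡ M′)
    ↠⇒run s r ε                           = [] , s , []ʳ , refl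
    ↠⇒run s r (_◅_ {j = M} (t , d) steps) =
      let r′ = reachable-fire r d
          v , f , rs , eq = ↠⇒run (M , [ r′ ]) r′ steps
      in t ∷ v , f , d ∷ʳ rs , eq

  -- Markings read off a firing sequence.

  module _ (w : List Transition) where

    private
      a : Fin (length w) → Transition
      a = List.lookup w

    -- The disjuncts have the shape of the conditions that `⊨AtMostOne` and `⊨AlternatePrecedence`
    -- impose at instant `k`. A natural number is used for `k` so that it can also be the length of
    -- `w`, the moment after the last firing.
    Marked : Place → ℕ → Set
    Marked p k =
      (p ≡ i × (∀ l → toℕ l < k → a l ∉ post p)) ⊎
      (∃[ j ] (toℕ j < k × a j ∈ pre p × (∀ l → j Fin.< l → toℕ l < k → a l ∉ post p)))

    below-suc : ∀ {Q : Fin (length w) → Set} k → (∀ l → l Fin.< k → Q l) → Q k →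
                ∀ l → toℕ l < suc (toℕ k) → Q l
    below-suc {Q} k below at-k l l<1+k with m≤n⇒m<n∨m≡n (s≤s⁻¹ l<1+k)
    ... | inj₁ l<k = below l l<k
    ... | inj₂ l≡k = subst Q (sym (toℕ-injective l≡k)) at-k

    -- The same recurrence as in `fire-marks`, so agreement between markings and `Marked` survives
    -- each firing.
    marked-suc : ∀ k p → Marked p (suc (toℕ k)) ⇔ (a k ∈ pre p ⊎ (a k ∉ post p × Marked p (toℕ k)))
    marked-suc k p = mk⇔ shrink extend
      where
      shrink : Marked p (suc (toℕ k)) → a k ∈ pre p ⊎ (a k ∉ post p × Marked p (toℕ k))
      shrink (inj₁ (p≡i , avoid)) =
        inj₂ (avoid k ≤-refl , inj₁ (p≡i , λ l l<k → avoid l (m<n⇒m<1+n l<k)))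
      shrink (inj₂ (j , j<1+k , j∈ , avoid)) with m≤n⇒m<n∨m≡n (s≤s⁻¹ j<1+k)
      ... | inj₁ j<k =
        inj₂ (avoid k j<k ≤-refl , inj₂ (j , j<k , j∈ , λ l j<l l<k → avoid l j<l (m<n⇒m<1+n l<k)))
      ... | inj₂ j≡k = inj₁ (subst (λ j → a j ∈ pre p) (toℕ-injective j≡k) j∈)

      extend : a k ∈ pre p ⊎ (a k ∉ post p × Marked p (toℕ k)) → Marked p (suc (toℕ k))
      extend (inj₁ k∈) =
        inj₂ (k , ≤-refl , k∈ , λ l k<l l<1+k → contradiction (<-≤-trans k<l (s≤s⁻¹ l<1+k)) (<-irrefl refl))
      extend (inj₂ (k∉ , inj₁ (p≡i , avoid))) = inj₁ (p≡i , below-suc k avoid k∉)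
      extend (inj₂ (k∉ , inj₂ (j , j<k , j∈ , avoid))) =
        inj₂ (j , m<n⇒m<1+n j<k , j∈ , λ l j<l l<1+k →
          -- Avoidance is required only after `j`, so the extended property is the implication from
          -- `j < l`.
          below-suc {λ l → j Fin.< l → a l ∉ post p} k (λ l l<k j<l → avoid l j<l l<k) (λ _ → k∉) l l<1+k j<l)

    marked-zero : ∀ p → Marked p 0 ⇔ p ≡ i
    marked-zero p = mk⇔ (λ { (inj₁ (p≡i , _)) → p≡i }) (λ p≡i → inj₁ (p≡i , λ _ ()))

    Tracks : Marking → ℕ → Set
    Tracks M k = ∀ p → 0 < lookup M p ⇔ Marked p k

    -- Enabledness of every letter when it fires, expressed without markings.
    Fireable : Set
    Fireable = ∀ k p → a k ∈ post p → Marked p (toℕ k)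

    -- For a non-empty word this amounts to the last letter lying in `pre p`; the quantified form is
    -- the one in `⊨End`.
    EndsInto : Place → Set
    EndsInto p = ∀ (k : Fin (length w)) → ∃[ j ] (k Fin.≤ j × a j ∈ pre p)

    tracks-M₀ : Tracks M₀ 0
    tracks-M₀ p = mk⇔ (from (marked-zero p) ∘ to (unit-lookup i p)) (from (unit-lookup i p) ∘ to (marked-zero p))

    -- Accepted firing sequences.

    module _ (safe : Safe W) (sound : Sound W) where

      open WorkflowNet.Sound sound

      private
        R : FSA Transition
        R = reachabilityFSA W safe

      tracks-fire : ∀ {M M′} c → Reachable M → M′ ≡ fire M (a c) → Tracks M (toℕ c) → Tracks M′ (suc (toℕ c))
      tracks-fire {M} c r refl tr p = mk⇔
        (from (marked-suc c p) ∘ Sum.map₂ (map₂ (to (tr p))) ∘ to (fire-marks M (a c) p (safe M r p)))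
        (from (fire-marks M (a c) p (safe M r p)) ∘ Sum.map₂ (map₂ (from (tr p))) ∘ to (marked-suc c p))

      -- The run is followed from position `k` up to instant `l`, where `Tracks` turns the
      -- enabledness recorded in the run into `Marked`.
      run⇒fireable : ∀ {s v f} k → Run R s v f → drop k w ≡ v → Reachable (value s) → Tracks (value s) k →
                     ∀ l p → k ≤ toℕ l → a l ∈ post p → Marked p (toℕ l)
      run⇒fireable k []ʳ eq r tr l p k≤l l∈ =
        contradiction (<-≤-trans (toℕ<n l) (≤-trans (drop-[] w k eq) k≤l)) (<-irrefl refl)
      run⇒fireable k (_ ∷ʳ _) eq r tr l p k≤l l∈ with drop-∷ w k eq
      run⇒fireable _ (d ∷ʳ rs) eq r tr l p k≤l l∈ | c , refl , refl , eq′ with m≤n⇒m<n∨m≡n k≤l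
      ... | inj₁ k<l = run⇒fireable (suc (toℕ c)) rs eq′ (reachable-fire r d) (tracks-fire c r (proj₂ d) tr) l p k<l l∈
      ... | inj₂ k≡l with toℕ-injective k≡l
      ...   | refl = to (tr p) (proj₁ d p l∈)

      -- If the last transition did not produce into o, then o was already marked,
      -- so it fired from M_f, which enables nothing.
      run⇒endsInto : ∀ {s v f} k → Run R s v f → drop k w ≡ v → Reachable (value s) → value f ≡ M_f →
                     0 < length v → ∃[ j ] (length w ≤ suc (toℕ j) × a j ∈ pre o)
      run⇒endsInto k (d ∷ʳ rs@(_ ∷ʳ _)) eq r fin _ =
        run⇒endsInto (suc k) rs (proj₂ (proj₂ (proj₂ (drop-∷ w k eq)))) (reachable-fire r d) fin (s≤s z≤n)
      run⇒endsInto k (d ∷ʳ []ʳ) eq r fin _ with drop-∷ w k eq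
      run⇒endsInto {s} _ (d ∷ʳ []ʳ) eq r fin _ | c , refl , refl , eq′
        with to (fire-marks (value s) (a c) o (safe _ r o))
                (subst (λ M → 0 < lookup M o) (trans (sym fin) (proj₂ d)) (from (unit-lookup o o) refl))
      ... | inj₁ c∈ = c , drop-[] w _ eq′ , c∈
      ... | inj₂ (_ , 0<o) =
        contradiction (subst (λ M → Enabled M (a c)) (properCompletion _ r 0<o) (proj₁ d)) (M_f-disabled (a c))

      -- `Tracks` turns `Marked` back into tokens, so each letter is enabled in turn. The bound on
      -- `k′` suffices later because every instant of `w` lies below it.
      fireable⇒run : Fireable → ∀ v k s → drop k w ≡ v → Reachable (value s) → Tracks (value s) k →
                     ∃[ f ] (Run R s v f × Reachable (value f) × ∃[ k′ ] (length w ≤ k′ × Tracks (value f) k′))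
      fireable⇒run fireable []      k s eq r tr = s , []ʳ , r , k , drop-[] w k eq , tr
      fireable⇒run fireable (t ∷ v) k s eq r tr with drop-∷ w k eq
      ... | c , refl , refl , eq′ =
        let d = (λ p c∈ → from (tr p) (fireable c p c∈)) , refl
            r′ = reachable-fire r d
            f , rs , rest = fireable⇒run fireable v (suc (toℕ c)) (fire (value s) (a c) , [ r′ ]) eq′ r′
                              (tracks-fire c r refl tr)
        in f , d ∷ʳ rs , rest

      accepts⇔fireable : 0 < length w → Accepts R w ⇔ (Fireable × EndsInto o)
      accepts⇔fireable 0<|w| = mk⇔
        (λ (_ , rs , fin) →
          (λ k p → run⇒fireable 0 rs refl ε tracks-M₀ k p z≤n) ,
          (λ k → let j , last , j∈ = run⇒endsInto 0 rs refl ε fin 0<|w| in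
            j , s≤s⁻¹ (≤-trans (toℕ<n k) last) , j∈))
        (λ (fireable , ends) →
          let f , rs , r , k , |w|≤k , tr = fireable⇒run fireable w 0 (initial R) refl ε tracks-M₀
              j , _ , j∈ = ends (fromℕ< 0<|w|)
          -- Nothing consumes from `o`, so one production into it leaves it marked to the end, and
          -- proper completion makes the final marking `M_f`.
          in f , rs , properCompletion _ r (from (tr o)
               (inj₂ (j , <-≤-trans (toℕ<n j) |w|≤k , j∈ , λ l _ _ l∈ → o-sink (a l , l∈)))))

  -- The constraints as conditions on the firing sequence.

  -- A place with empty preset is `i`, which can only lose its initial token, as `AtMostOne` says.
  -- Any other place from which some letter consumes has non-empty preset and postset, so its
  -- precedence constraint is present.
  𝒟⇔fireable : ∀ π → All (λ c → π ⊨ formula c) (𝒟 W) ⇔ (Fireable (toList π) × EndsInto (toList π) o)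
  𝒟⇔fireable π = mk⇔ sound complete
    where
    w = toList π

    relevant? : ∀ p → Dec (Nonempty (pre p) × Nonempty (post p))
    relevant? p = nonempty? (pre p) ×-dec nonempty? (post p)

    precedence : Place → Constraint (#T W)
    precedence p = AlternatePrecedence (pre p) (post p)

    precedences : Specification (#T W)
    precedences = List.map precedence (filter relevant? (allFin #P))

    sound : All (λ c → π ⊨ formula c) (𝒟 W) → Fireable w × EndsInto w o
    sound h with deduplicate⁻ _≟ᶜ_ (λ { refl → id })
                     (AtMostOne (post i) ∷ End (pre o) ∷ precedences) h
    ... | amo ∷ end ∷ aps = fireable , to (⊨End π (pre o)) end
      where
      fireable : Fireable w
      fireable k p k∈ with nonempty? (pre p)
      ... | yes ne = inj₂ (to (⊨AlternatePrecedence π (pre p) (post p))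
              (All.lookup (All.map⁻ {f = precedence} aps) (∈-filter⁺ relevant? (∈-allFin p) (ne , (_ , k∈)))) k k∈)
      ... | no  e with i-unique p e
      ...   | refl = inj₁ (refl , to (⊨AtMostOne π (post i)) amo k k∈)

    complete : Fireable w × EndsInto w o → All (λ c → π ⊨ formula c) (𝒟 W)
    complete (fireable , ends) = deduplicate⁺ _≟ᶜ_ {xs = AtMostOne (post i) ∷ End (pre o) ∷ precedences}
      (from (⊨AtMostOne π (post i)) amo ∷ from (⊨End π (pre o)) ends ∷
       All.map⁺ {f = precedence} (All.map (λ {p} (ne , _) → from (⊨AlternatePrecedence π (pre p) (post p)) (ap p ne))
                         (all-filter relevant? (allFin #P))))
      where
      amo : ∀ k → List.lookup w k ∈ post i → ∀ l → l Fin.< k → List.lookup w l ∉ post i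
      amo k k∈ with fireable k i k∈
      ... | inj₁ (_ , avoid) = avoid
      ... | inj₂ (j , _ , j∈ , _) = contradiction (_ , j∈) i-source

      ap : ∀ p → Nonempty (pre p) → ∀ k → List.lookup w k ∈ post p →
           ∃[ j ] (j Fin.< k × List.lookup w j ∈ pre p ×
                   (∀ l → j Fin.< l → l Fin.< k → List.lookup w l ∉ post p))
      ap p ne k k∈ with fireable k p k∈
      ... | inj₁ (refl , _) = contradiction ne i-source
      ... | inj₂ since = since

  -- Equality of the two languages.

  module _ (safe : Safe W) (sound : Sound W) (0<#T : 0 < #T W) (𝒜 : All ConstraintAutomaton (𝒟 W)) where

    open WorkflowNet.Sound sound

    private
      R D : FSA Transition
      R = reachabilityFSA W safe
      D = specificationProduct 𝒜

    same-language : ∀ w → Accepts R w ⇔ Accepts D w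
    same-language w = mk⇔ (⊆ w) ⊇
      where
      ⊆ : ∀ w → Accepts R w → Accepts D w
      -- The empty word would force `M₀` to equal `M_f`, hence `i` to equal `o`.
      ⊆ []      (_ , []ʳ , M₀≡M_f) = contradiction
        (to (unit-lookup o i) (subst (λ M → 0 < lookup M i) M₀≡M_f (from (unit-lookup i i) refl))) (i≢o 0<#T)
      ⊆ (t ∷ v) acc = from (specificationProduct-accepts 𝒜 (t ∷ v))
        (All.map (λ {c} sat → t ∷ v , refl , sat)
          (from (𝒟⇔fireable (t ∷ v)) (to (accepts⇔fireable (t ∷ v) safe sound (s≤s z≤n)) acc)))

      ⊇ : Accepts D w → Accepts R w
      ⊇ acc with to (specificationProduct-accepts 𝒜 w) acc
      -- `𝒟 W` always contains its first constraint, whose trace already shows that `w` is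
      -- non-empty; matching on `refl` identifies the other traces with it.
      ... | cs@((t ∷ v , refl , _) ∷ _) = from (accepts⇔fireable w safe sound (s≤s z≤n))
        (to (𝒟⇔fireable (t ∷ v)) (All.map (λ { (_ ∷ _ , refl , sat) → sat }) cs))

    reachable-coaccessible : ∀ {w s} → Run R (initial R) w s → ∃[ v ] ∃[ f ] (Run R s v f × Accepting R f)
    reachable-coaccessible {s = s} rs =
      let r = run-reachable safe rs ε in ↠⇒run safe s r (optionToComplete _ r)

    -- Enabledness is decided from the marking alone; the irrelevant reachability proof is needed
    -- only inside the irrelevant component of the new state.
    δ? : ∀ s t → Dec (∃[ s′ ] δ R s t s′)
    δ? (M , [ r ]) t = map′
      (λ en → (fire M t , [ reachable-fire r (en , refl) ]) , en , refl) (proj₁ ∘ proj₂) (enabled? M t)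

    -- Option to complete at `M₀` supplies an accepted firing sequence.
    specification-nonempty : ∃ (Accepts D)
    specification-nonempty =
      let w , acc = reachable-coaccessible []ʳ in w , to (same-language w) acc

corollary1 : (W : WorkflowNet) (safe : Safe W) → Sound W → 0 < #T W →
    (𝒜 : All ConstraintAutomaton (𝒟 W)) →
    ∃[ nonempty ] Bisimilar (reachabilityFSA W safe) (specificationFSA 𝒜 nonempty)
corollary1 W safe sound 0<#T 𝒜 =
  specification-nonempty W safe sound 0<#T 𝒜 ,
  language≡⇒bisimilar (reachabilityFSA W safe) (specificationProduct 𝒜)
    (reachable-coaccessible W safe sound 0<#T 𝒜) (δ? W safe sound 0<#T 𝒜)
    (same-language W safe sound 0<#T 𝒜) (specification-nonempty W safe sound 0<#T 𝒜)
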